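{- Let $V$ be a variety in a language $L$, and consider presentations with a fixed generating tuple $\bar a$ and $k$ identities. Let $L'$ be the result of adding to $L$ constants for the generators $\bar a$. Let $T_F$ be the set of $L'$-sentences true in the free structure $F$ generated by $\bar a$, and let $S$ be the set of $L'$-sentences with limiting density $1$. Then the following are equivalent: (1) $T_F\subseteq S$; (2) $T_F=S$; (3) $S$ has the following two properties: (a) $S$ includes the sentences from $T_F$ of the form $t(\bar a)\ne t'(\bar a)$; (b) for any $L'$-formula $\varphi(x)$ with just $x$ free, if $\varphi(t(\bar a))\in S$ for all closed terms $t(\bar a)$, then $(\forall x)\varphi(x)\in S$.
   Context: The language $L$ is algebraic (only function symbols and constants). A variety is a class of $L$-structures axiomatized by universally quantified equations; $T$ is the theory generated by the axioms. A presentation $\bar a|R$ consists of the fixed tuple $\bar a$ of generators and an unordered set $R$ of $k$ distinct identities $t(\bar a)=t'(\bar a)$ drawn from a fixed class of allowable identities, each having a length in $\mathbb{N}$, with only finitely many allowable identities of each length (and at least one allowable presentation with identities of length at most $s$ for all large $s$). $\langle\bar a|R\rangle$ is the member of $V$ generated by $\bar a$ in which the equations between closed terms in $\bar a$ that hold are exactly those that follow logically from $T\cup R$; the new constants of $L'$ are interpreted as the generators. The free structure $F$ is the one given by the empty set of identities. $P_s$ is the number of presentations in which all identities have length at most $s$, and $P_s(\varphi)$ is the number of these for which $\langle\bar a|R\rangle\models\varphi$. A sentence $\varphi$ has limiting density $d$ if $\lim_{s\to\infty}P_s(\varphi)/P_s=d$. -}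

module Defs where

open import Level using (Level; _⊔_; 0ℓ) renaming (suc to lsuc)
open import Axiom.ExcludedMiddle using (ExcludedMiddle)
open import Data.Nat.Base using (ℕ; zero; suc; _≤_)
open import Data.Integer.Base using (+_)
open import Data.Rational.Base using (ℚ; 0ℚ; 1ℚ; _/_; _-_; ∣_∣; _<_)
open import Data.Fin.Base using (Fin; zero; suc)
open import Data.Vec.Base as Vec using (Vec; []; _∷_)
open import Data.Vec.Relation.Binary.Pointwise.Inductive using (Pointwise; []; _∷_)
open import Data.List.Base as List using (List; []; _∷_; _++_; filter; concatMap; upTo; length)
open import Data.List.Membership.Propositional using (_∈_)
open import Data.List.Relation.Unary.Unique.Propositional using (Unique)
open import Data.Product.Base using (Σ; _×_; _,_; proj₁; proj₂; ∃-syntax)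
open import Data.Sum.Base using (_⊎_; inj₁; inj₂; [_,_])
open import Function.Base using (_∘_; const)
open import Function.Bundles using (_⇔_)
open import Relation.Binary.Bundles using (Setoid)
open import Relation.Binary.PropositionalEquality using (_≡_; refl; cong; cong₂)
import Relation.Binary.PropositionalEquality as ≡
open import Relation.Nullary.Negation.Core using (¬_)
open import Relation.Unary using (Pred)

private variable
  ℓ c e : Level
  m n k : ℕ

-- Constants are the function symbols of arity 0.
record Language (ℓ : Level) : Set (lsuc ℓ) where
  field
    Fun   : Set ℓ
    arity : Fun → ℕ

open Language

-- Terms and formulas have their free variables among n de Bruijn variables.
data Term (L : Language ℓ) (n : ℕ) : Set ℓ where
  var : Fin n → Term L n
  app : (f : Fun L) → Vec (Term L n) (arity L f) → Term L n

infix  7 _≈̇_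
infixr 6 _∧̇_
infixr 5 _∨̇_
infixr 4 _⇒̇_

data Formula (L : Language ℓ) (n : ℕ) : Set ℓ where
  _≈̇_           : (t u : Term L n) → Formula L n
  ¬̇_            : Formula L n → Formula L n
  _∧̇_ _∨̇_ _⇒̇_   : (φ ψ : Formula L n) → Formula L n
  ∀̇_ ∃̇_         : Formula L (suc n) → Formula L n

ClosedTerm : Language ℓ → Set ℓ
ClosedTerm L = Term L 0

Sentence : Language ℓ → Set ℓ
Sentence L = Formula L 0

module _ {L : Language ℓ} where

  mutual
    substᵗ : (Fin m → Term L n) → Term L m → Term L n
    substᵗ σ (var x)    = σ x
    substᵗ σ (app f ts) = app f (substᵗˢ σ ts)

    substᵗˢ : (Fin m → Term L n) → Vec (Term L m) k → Vec (Term L n) k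
    substᵗˢ σ []       = []
    substᵗˢ σ (t ∷ ts) = substᵗ σ t ∷ substᵗˢ σ ts

  lift : (Fin m → Term L n) → Fin (suc m) → Term L (suc n)
  lift σ zero    = var zero
  lift σ (suc x) = substᵗ (var ∘ suc) (σ x)

  substᶠ : (Fin m → Term L n) → Formula L m → Formula L n
  substᶠ σ (t ≈̇ u) = substᵗ σ t ≈̇ substᵗ σ u
  substᶠ σ (¬̇ φ)   = ¬̇ substᶠ σ φ
  substᶠ σ (φ ∧̇ ψ) = substᶠ σ φ ∧̇ substᶠ σ ψ
  substᶠ σ (φ ∨̇ ψ) = substᶠ σ φ ∨̇ substᶠ σ ψ
  substᶠ σ (φ ⇒̇ ψ) = substᶠ σ φ ⇒̇ substᶠ σ ψ
  substᶠ σ (∀̇ φ)   = ∀̇ substᶠ (lift σ) φ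
  substᶠ σ (∃̇ φ)   = ∃̇ substᶠ (lift σ) φ

  infix 8 _[_]
  _[_] : Formula L 1 → ClosedTerm L → Sentence L
  φ [ t ] = substᶠ (const t) φ

-- Equality is a setoid equality, so that quotients of term algebras are
-- structures.
record Structure (L : Language ℓ) (c e : Level) : Set (ℓ ⊔ lsuc (c ⊔ e)) where
  field
    domain : Setoid c e
  open Setoid domain public using (Carrier; _≈_; isEquivalence)
  field
    interp      : (f : Fun L) → Vec Carrier (arity L f) → Carrier
    interp-cong : ∀ f {as bs} → Pointwise _≈_ as bs → interp f as ≈ interp f bs

module _ {L : Language ℓ} (M : Structure L c e) where
  open Structure M

  mutual
    eval : (Fin n → Carrier) → Term L n → Carrier
    eval ρ (var x)    = ρ x
    eval ρ (app f ts) = interp f (evals ρ ts)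

    evals : (Fin n → Carrier) → Vec (Term L n) k → Vec Carrier k
    evals ρ []       = []
    evals ρ (t ∷ ts) = eval ρ t ∷ evals ρ ts

  extend : Carrier → (Fin n → Carrier) → Fin (suc n) → Carrier
  extend a ρ zero    = a
  extend a ρ (suc x) = ρ x

  Sat : (Fin n → Carrier) → Formula L n → Set (c ⊔ e)
  Sat ρ (t ≈̇ u) = Level.Lift c (eval ρ t ≈ eval ρ u)
  Sat ρ (¬̇ φ)   = ¬ Sat ρ φ
  Sat ρ (φ ∧̇ ψ) = Sat ρ φ × Sat ρ ψ
  Sat ρ (φ ∨̇ ψ) = Sat ρ φ ⊎ Sat ρ ψ
  Sat ρ (φ ⇒̇ ψ) = Sat ρ φ → Sat ρ ψ
  Sat ρ (∀̇ φ)   = ∀ a → Sat (extend a ρ) φ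
  Sat ρ (∃̇ φ)   = ∃[ a ] Sat (extend a ρ) φ

noVars : {A : Set c} → Fin 0 → A
noVars ()

infix 4 _⊨_
_⊨_ : {L : Language ℓ} → Structure L c e → Sentence L → Set (c ⊔ e)
M ⊨ φ = Sat M noVars φ

-- (n , t , u) stands for the sentence ∀ x₁ … xₙ. t = u.
Equation : Language ℓ → Set ℓ
Equation L = Σ ℕ λ n → Term L n × Term L n

Valid : {L : Language ℓ} → Structure L c e → Equation L → Set (c ⊔ e)
Valid {c = c} M (n , t , u) = ∀ (ρ : Fin n → Carrier) → eval M ρ t ≈ eval M ρ u
  where open Structure M

-- A variety is represented by its set of axioms; the class it denotes is
-- given by _∈ⱽ_, and T is the set of consequences of the axioms.
Variety : Language ℓ → Set (lsuc ℓ)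
Variety {ℓ} L = Pred (Equation L) ℓ

infix 4 _∈ⱽ_
_∈ⱽ_ : {L : Language ℓ} → Structure L c e → Variety L → Set (ℓ ⊔ c ⊔ e)
M ∈ⱽ V = ∀ eq → V eq → Valid M eq

_⊕_ : Language ℓ → ℕ → Language ℓ
Fun   (L ⊕ m) = Fun L ⊎ Fin m
arity (L ⊕ m) = [ arity L , const 0 ]

reduct : {L : Language ℓ} → Structure (L ⊕ m) c e → Structure L c e
reduct M = record
  { domain      = domain
  ; interp      = λ f → interp (inj₁ f)
  ; interp-cong = λ f → interp-cong (inj₁ f)
  } where open Structure M

-- An identity t(ā) = t′(ā), as the ordered pair of its two sides.
Identity : Language ℓ → ℕ → Set ℓ
Identity L m = ClosedTerm (L ⊕ m) × ClosedTerm (L ⊕ m)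

Holds : {L : Language ℓ} → Structure (L ⊕ m) c e → Identity L m → Set e
Holds M (t , u) = eval M noVars t ≈ eval M noVars u
  where open Structure M

module _ {L : Language ℓ} (V : Variety L) {m : ℕ} where

  -- Logical consequence of T ∪ R: truth in all its models.  Quantifying over
  -- models in universe ℓ raises the equality of ⟨ R ⟩ to the next universe.
  Follows : List (Identity L m) → Identity L m → Set (lsuc ℓ)
  Follows R i = (M : Structure (L ⊕ m) ℓ ℓ) →
                reduct M ∈ⱽ V → (∀ j → j ∈ R → Holds M j) → Holds M i

  ⟨_⟩ : List (Identity L m) → Structure (L ⊕ m) ℓ (lsuc ℓ)
  ⟨ R ⟩ = record
    { domain = record
      { Carrier = ClosedTerm (L ⊕ m)
      ; _≈_     = λ t u → Follows R (t , u)
      ; isEquivalence = record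
        { refl  = λ M _ _ → Setoid.refl (domain M)
        ; sym   = λ p M v r → Setoid.sym (domain M) (p M v r)
        ; trans = λ p q M v r → Setoid.trans (domain M) (p M v r) (q M v r)
        }
      }
    ; interp      = app
    ; interp-cong = λ f ps M v r → interp-cong M f (pointwise M v r ps)
    }
    where
    open Structure
    pointwise : ∀ {n} (M : Structure (L ⊕ m) ℓ ℓ) → reduct M ∈ⱽ V →
                (∀ j → j ∈ R → Holds M j) →
                {ts us : Vec (ClosedTerm (L ⊕ m)) n} →
                Pointwise (λ t u → Follows R (t , u)) ts us →
                Pointwise (_≈_ M) (evals M noVars ts) (evals M noVars us)
    pointwise M v r []       = []
    pointwise M v r (p ∷ ps) = p M v r ∷ pointwise M v r ps

  Free : Structure (L ⊕ m) ℓ (lsuc ℓ)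
  Free = ⟨ [] ⟩

  -- The remaining lemmas confirm that ⟨ R ⟩ is a member of V generated by
  -- the constants, in which exactly the consequences of T ∪ R hold.

  mutual
    eval-⟨⟩ : ∀ R t → eval ⟨ R ⟩ noVars t ≡ t
    eval-⟨⟩ R (app f ts) = cong (app f) (evals-⟨⟩ R ts)

    evals-⟨⟩ : ∀ R (ts : Vec (ClosedTerm (L ⊕ m)) n) → evals ⟨ R ⟩ noVars ts ≡ ts
    evals-⟨⟩ R []       = refl
    evals-⟨⟩ R (t ∷ ts) = cong₂ _∷_ (eval-⟨⟩ R t) (evals-⟨⟩ R ts)

  holds-⟨⟩ : ∀ R i → Holds ⟨ R ⟩ i ≡ Follows R i
  holds-⟨⟩ R (t , u) = cong₂ (λ t u → Follows R (t , u)) (eval-⟨⟩ R t) (eval-⟨⟩ R u)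

  ⟨⟩-∈ⱽ : ∀ R → reduct ⟨ R ⟩ ∈ⱽ V
  ⟨⟩-∈ⱽ R (n , t , u) ax ρ M v r =
    ≡.subst₂ (Structure._≈_ M) (≡.sym (eval-reduct t)) (≡.sym (eval-reduct u))
      (v (n , t , u) ax (eval M noVars ∘ ρ))
    where
    mutual
      eval-reduct : ∀ t → eval M noVars (eval (reduct ⟨ R ⟩) ρ t)
                        ≡ eval (reduct M) (eval M noVars ∘ ρ) t
      eval-reduct (var x)    = refl
      eval-reduct (app f ts) = cong (Structure.interp M (inj₁ f)) (evals-reduct ts)

      evals-reduct : ∀ {k} (ts : Vec (Term L n) k) →
                     evals M noVars (evals (reduct ⟨ R ⟩) ρ ts)
                     ≡ evals (reduct M) (eval M noVars ∘ ρ) ts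
      evals-reduct []       = refl
      evals-reduct (t ∷ ts) = cong₂ _∷_ (eval-reduct t) (evals-reduct ts)

Finite : ∀ {a p} {A : Set a} → Pred A p → Set (a ⊔ p)
Finite P = ∃[ xs ] (Unique xs × (∀ x → P x ⇔ x ∈ xs))

-- For a duplicate-free xs, choose k xs lists every k-element subset of xs
-- exactly once, with its elements in the order they have in xs.
choose : ∀ {a} {A : Set a} → ℕ → List A → List (List A)
choose zero    _        = [] ∷ []
choose (suc k) []       = []
choose (suc k) (x ∷ xs) = List.map (x ∷_) (choose k xs) ++ choose (suc k) xs

record Presentations (L : Language ℓ) (m k : ℕ) : Set (lsuc ℓ) where
  field
    Allowable : Pred (Identity L m) ℓ
    -- Only the values on allowable identities matter.
    len       : Identity L m → ℕ
    finite    : ∀ l → Finite (λ i → Allowable i × len i ≡ l)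

  identities≤ : ℕ → List (Identity L m)
  identities≤ s = concatMap (λ l → proj₁ (finite l)) (upTo (suc s))

  presentations≤ : ℕ → List (List (Identity L m))
  presentations≤ s = choose k (identities≤ s)

  field
    inhabited : ∃[ s₀ ] (∀ s → s₀ ≤ s → ∃[ R ] R ∈ presentations≤ s)

Limit : (ℕ → ℚ) → ℚ → Set
Limit q d = ∀ ε → 0ℚ < ε → ∃[ N ] (∀ s → N ≤ s → ∣ q s - d ∣ < ε)

-- The value for denominator 0 is junk; the ratio is applied to counts
-- that are eventually positive.
ratio : ℕ → ℕ → ℚ
ratio p zero    = 0ℚ
ratio p (suc n) = + p / suc n

-- Excluded middle is what makes "the number of R with ⟨ R ⟩ ⊨ φ" a number.
module Density (em : ExcludedMiddle (lsuc ℓ)) {L : Language ℓ} (V : Variety L)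
               {m k : ℕ} (𝒫 : Presentations L m k) where
  open Presentations 𝒫

  P : ℕ → ℕ
  P s = length (presentations≤ s)

  P[_] : Sentence (L ⊕ m) → ℕ → ℕ
  P[ φ ] s = length (filter (λ R → em {⟨ V ⟩ R ⊨ φ}) (presentations≤ s))

  HasLimitingDensity : Sentence (L ⊕ m) → ℚ → Set
  HasLimitingDensity φ d = Limit (λ s → ratio (P[ φ ] s) (P s)) d

  T-F : Pred (Sentence (L ⊕ m)) (lsuc ℓ)
  T-F φ = Free V ⊨ φ

  S : Pred (Sentence (L ⊕ m)) 0ℓ
  S φ = HasLimitingDensity φ 1ℚ

  ContainsFreeInequations : Set (lsuc ℓ)
  ContainsFreeInequations =
    ∀ (t t′ : ClosedTerm (L ⊕ m)) → T-F (¬̇ (t ≈̇ t′)) → S (¬̇ (t ≈̇ t′))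

  ClosedUnderGeneralization : Set ℓ
  ClosedUnderGeneralization =
    ∀ (φ : Formula (L ⊕ m) 1) → (∀ t → S (φ [ t ])) → S (∀̇ φ)

{-# OPTIONS --safe #-}

-- A property of presentations that fails in none of them, or that follows from
-- two properties of density 1, has density 1, and no property has density 1
-- together with its negation.  The latter makes T_F ⊆ S an equality, as T_F is
-- complete.  Since the elements of F are named by closed terms, F satisfies
-- ∀x φ(x) once it satisfies every φ(t), which gives (b).  Conversely, if S
-- satisfies (a) and (b), induction on φ shows that a formula true (false) in F
-- under an assignment of closed terms is true (false) under it with density 1:
-- an equation true in F is true in every presentation, (a) treats the
-- inequations and (b) the universal statements.

module Submission where

open import Defs
open import Level using (Level; suc; Lift) renaming (lift to lift↑)
open import Axiom.ExcludedMiddle using (ExcludedMiddle)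
open import Data.Empty using (⊥)
open import Data.Fin.Base as Fin using (Fin)
open import Data.Integer.Base as ℤ using (+_)
import Data.Integer.Properties as ℤ
open import Data.List.Base using (List; []; _∷_; filter; length)
open import Data.List.Membership.Propositional using (_∈_)
open import Data.List.Properties using (length-filter; filter-all; filter-none)
open import Data.List.Relation.Unary.All using (universal)
open import Data.Nat.Base as ℕ using (ℕ)
import Data.Nat.Properties as ℕ
open import Data.Product.Base using (_×_; _,_; ∃-syntax; proj₁; proj₂; map₂)
open import Data.Rational.Base as ℚ using (ℚ; 0ℚ; 1ℚ; ½)
import Data.Rational.Properties as ℚ
open import Data.Rational.Solver using (module +-*-Solver)
import Data.Rational.Unnormalised.Base as ℚᵘ
import Data.Rational.Unnormalised.Properties as ℚᵘ
open import Data.Sum.Base as Sum using (inj₁; inj₂)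
open import Data.Vec.Base using (Vec; []; _∷_)
open import Function.Base using (_∘_; const)
open import Function.Bundles using (_⇔_; mk⇔; Equivalence)
open import Relation.Binary.PropositionalEquality hiding ([_])
open import Relation.Nullary.Decidable.Core using (yes; no; decidable-stable)
open import Relation.Nullary.Negation.Core using (¬_; contradiction)
open import Relation.Unary using (Pred; Decidable; _⊆_; _≐_)

open Equivalence using (to; from)

private variable
  ℓ c e a p q r : Level
  m n k : ℕ

-- Arithmetic of proportions with a common denominator.

+-/ : ∀ i j d → (+ i ℚ./ ℕ.suc d) ℚ.+ (+ j ℚ./ ℕ.suc d) ≡ + (i ℕ.+ j) ℚ./ ℕ.suc d
-- Rationals are kept in lowest terms, so the sum is computed with unnormalised fractions, where
-- only cross-multiplication remains.
+-/ i j d = ℚ.toℚᵘ-injective (begin-equality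
  ℚ.toℚᵘ ((+ i ℚ./ ℕ.suc d) ℚ.+ (+ j ℚ./ ℕ.suc d))
    ≃⟨ ℚ.toℚᵘ-homo-+ (+ i ℚ./ ℕ.suc d) (+ j ℚ./ ℕ.suc d) ⟩
  ℚ.toℚᵘ (+ i ℚ./ ℕ.suc d) ℚᵘ.+ ℚ.toℚᵘ (+ j ℚ./ ℕ.suc d)
    ≃⟨ ℚᵘ.+-cong (ℚ.toℚᵘ-fromℚᵘ (ℚᵘ.mkℚᵘ (+ i) d)) (ℚ.toℚᵘ-fromℚᵘ (ℚᵘ.mkℚᵘ (+ j) d)) ⟩
  ℚᵘ.mkℚᵘ (+ i) d ℚᵘ.+ ℚᵘ.mkℚᵘ (+ j) d
    ≃⟨ ℚᵘ.*≡* common-denominator ⟩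
  ℚᵘ.mkℚᵘ (+ (i ℕ.+ j)) d
    ≃⟨ ℚ.toℚᵘ-fromℚᵘ (ℚᵘ.mkℚᵘ (+ (i ℕ.+ j)) d) ⟨
  ℚ.toℚᵘ (+ (i ℕ.+ j) ℚ./ ℕ.suc d) ∎)
  where
  open ℚᵘ.≤-Reasoning
  D = + ℕ.suc d
  common-denominator : (+ i ℤ.* D ℤ.+ + j ℤ.* D) ℤ.* D ≡ + (i ℕ.+ j) ℤ.* (D ℤ.* D)
  common-denominator = trans (cong (ℤ._* D) (sym (ℤ.*-distribʳ-+ D (+ i) (+ j))))
                             (ℤ.*-assoc (+ (i ℕ.+ j)) D D)

/-monoˡ-≤ : ∀ d {i j} → i ℕ.≤ j → + i ℚ./ ℕ.suc d ℚ.≤ + j ℚ./ ℕ.suc d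
/-monoˡ-≤ d {i} {j} i≤j = ℚ.toℚᵘ-cancel-≤ (begin
  ℚ.toℚᵘ (+ i ℚ./ ℕ.suc d) ≃⟨ ℚ.toℚᵘ-fromℚᵘ (ℚᵘ.mkℚᵘ (+ i) d) ⟩
  ℚᵘ.mkℚᵘ (+ i) d          ≤⟨ ℚᵘ.*≤* (ℤ.*-monoʳ-≤-nonNeg (+ ℕ.suc d) (ℤ.+≤+ i≤j)) ⟩
  ℚᵘ.mkℚᵘ (+ j) d          ≃⟨ ℚ.toℚᵘ-fromℚᵘ (ℚᵘ.mkℚᵘ (+ j) d) ⟨
  ℚ.toℚᵘ (+ j ℚ./ ℕ.suc d) ∎)
  where open ℚᵘ.≤-Reasoning

n/n≡1 : ∀ d → + ℕ.suc d ℚ./ ℕ.suc d ≡ 1ℚ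
n/n≡1 d = ℚ.fromℚᵘ-cong {ℚᵘ.mkℚᵘ (+ ℕ.suc d) d} {ℚᵘ.1ℚᵘ} (ℚᵘ.*≡* (ℤ.*-comm (+ ℕ.suc d) (+ 1)))

ratio-≤1 : ∀ {i} d → i ℕ.≤ d → ratio i d ℚ.≤ 1ℚ
ratio-≤1 ℕ.zero    _   = ℚ.<⇒≤ (ℚ.positive⁻¹ 1ℚ)
ratio-≤1 (ℕ.suc d) i≤d = ℚ.≤-trans (/-monoˡ-≤ d i≤d) (ℚ.≤-reflexive (n/n≡1 d))

ratio-+-≤ : ∀ {i j l} d → i ℕ.+ j ℕ.≤ d ℕ.+ l → ratio i d ℚ.+ ratio j d ℚ.≤ 1ℚ ℚ.+ ratio l d
-- A zero denominator makes all three ratios 0, which leaves `0 ≤ 1`.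
ratio-+-≤ ℕ.zero _ = ℚ.<⇒≤ (ℚ.positive⁻¹ 1ℚ)
ratio-+-≤ {i} {j} {l} (ℕ.suc d) i+j≤d+l = begin
  (+ i ℚ./ ℕ.suc d) ℚ.+ (+ j ℚ./ ℕ.suc d)       ≡⟨ +-/ i j d ⟩
  + (i ℕ.+ j) ℚ./ ℕ.suc d                       ≤⟨ /-monoˡ-≤ d i+j≤d+l ⟩
  + (ℕ.suc d ℕ.+ l) ℚ./ ℕ.suc d                 ≡⟨ +-/ (ℕ.suc d) l d ⟨
  (+ ℕ.suc d ℚ./ ℕ.suc d) ℚ.+ (+ l ℚ./ ℕ.suc d) ≡⟨ cong (ℚ._+ (+ l ℚ./ ℕ.suc d)) (n/n≡1 d) ⟩
  1ℚ ℚ.+ (+ l ℚ./ ℕ.suc d)                      ∎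
  where open ℚ.≤-Reasoning

ratio-0 : ∀ d → ratio 0 d ≡ 0ℚ
ratio-0 ℕ.zero    = refl
ratio-0 (ℕ.suc d) = ℚ.fromℚᵘ-cong {ℚᵘ.mkℚᵘ (+ 0) d} {ℚᵘ.0ℚᵘ} (ℚᵘ.*≡* refl)

-- Convergence to 1 from below.

∣x-1∣≡1-x : ∀ {x} → x ℚ.≤ 1ℚ → ℚ.∣ x ℚ.- 1ℚ ∣ ≡ 1ℚ ℚ.- x
∣x-1∣≡1-x {x} x≤1 = begin
  ℚ.∣ x ℚ.- 1ℚ ∣         ≡⟨ ℚ.∣-p∣≡∣p∣ (x ℚ.- 1ℚ) ⟨
  ℚ.∣ ℚ.- (x ℚ.- 1ℚ) ∣   ≡⟨ cong ℚ.∣_∣ (solve 2 (λ x y → :- (x :- y) := y :- x) refl x 1ℚ) ⟩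
  ℚ.∣ 1ℚ ℚ.- x ∣         ≡⟨ ℚ.0≤p⇒∣p∣≡p 0≤1-x ⟩
  1ℚ ℚ.- x               ∎
  where
  open ≡-Reasoning
  open +-*-Solver
  0≤1-x : 0ℚ ℚ.≤ 1ℚ ℚ.- x
  0≤1-x = subst (ℚ._≤ 1ℚ ℚ.- x) (ℚ.+-inverseʳ x) (ℚ.+-monoˡ-≤ (ℚ.- x) x≤1)

-- The deficits satisfy `1 - w ≤ (1 - u) + (1 - v)`, and each deficit on the right is eventually
-- below half of `ε`.
Limit-1-∧ : ∀ {u v w : ℕ → ℚ} →
            (∀ s → u s ℚ.≤ 1ℚ) → (∀ s → v s ℚ.≤ 1ℚ) → (∀ s → w s ℚ.≤ 1ℚ) →
            (∀ s → u s ℚ.+ v s ℚ.≤ 1ℚ ℚ.+ w s) →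
            Limit u 1ℚ → Limit v 1ℚ → Limit w 1ℚ
Limit-1-∧ {u} {v} {w} u≤1 v≤1 w≤1 u+v≤1+w u→1 v→1 ε 0<ε =
  N₁ ℕ.⊔ N₂ , λ s N≤s → begin-strict
    ℚ.∣ w s ℚ.- 1ℚ ∣                      ≡⟨ ∣x-1∣≡1-x (w≤1 s) ⟩
    1ℚ ℚ.- w s                            ≡⟨ lhs 1ℚ (u s) (v s) (w s) ⟨
    (u s ℚ.+ v s) ℚ.+ shift s             ≤⟨ ℚ.+-monoˡ-≤ (shift s) (u+v≤1+w s) ⟩
    (1ℚ ℚ.+ w s) ℚ.+ shift s              ≡⟨ rhs 1ℚ (u s) (v s) (w s) ⟩
    (1ℚ ℚ.- u s) ℚ.+ (1ℚ ℚ.- v s)         ≡⟨ cong₂ ℚ._+_ (∣x-1∣≡1-x (u≤1 s)) (∣x-1∣≡1-x (v≤1 s)) ⟨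
    ℚ.∣ u s ℚ.- 1ℚ ∣ ℚ.+ ℚ.∣ v s ℚ.- 1ℚ ∣ <⟨ ℚ.+-mono-< (u-close s (ℕ.m⊔n≤o⇒m≤o N₁ N₂ N≤s))
                                                       (v-close s (ℕ.m⊔n≤o⇒n≤o N₁ N₂ N≤s)) ⟩
    ½ ℚ.* ε ℚ.+ ½ ℚ.* ε                   ≡⟨ ℚ.*-distribʳ-+ ε ½ ½ ⟨
    1ℚ ℚ.* ε                              ≡⟨ ℚ.*-identityˡ ε ⟩
    ε                                     ∎
  where
  open ℚ.≤-Reasoning
  open +-*-Solver
  0<ε/2 : 0ℚ ℚ.< ½ ℚ.* ε
  0<ε/2 = subst (ℚ._< ½ ℚ.* ε) (ℚ.*-zeroʳ ½) (ℚ.*-monoʳ-<-pos ½ 0<ε)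
  N₁      = proj₁ (u→1 (½ ℚ.* ε) 0<ε/2)
  N₂      = proj₁ (v→1 (½ ℚ.* ε) 0<ε/2)
  u-close = proj₂ (u→1 (½ ℚ.* ε) 0<ε/2)
  v-close = proj₂ (v→1 (½ ℚ.* ε) 0<ε/2)
  -- Adding this to both sides of `u + v ≤ 1 + w` turns it into the inequality between deficits.
  shift : ℕ → ℚ
  shift s = 1ℚ ℚ.- u s ℚ.- v s ℚ.- w s
  lhs : ∀ i x y z → (x ℚ.+ y) ℚ.+ (i ℚ.- x ℚ.- y ℚ.- z) ≡ i ℚ.- z
  lhs = solve 4 (λ i x y z → (x :+ y) :+ (i :- x :- y :- z) := i :- z) refl
  rhs : ∀ i x y z → (i ℚ.+ z) ℚ.+ (i ℚ.- x ℚ.- y ℚ.- z) ≡ (i ℚ.- x) ℚ.+ (i ℚ.- y)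
  rhs = solve 4 (λ i x y z → (i :+ z) :+ (i :- x :- y :- z) := (i :- x) :+ (i :- y)) refl

-- Counting the elements with a property.

module _ {A : Set a} {P : Pred A p} {Q : Pred A q} {R : Pred A r}
         (P? : Decidable P) (Q? : Decidable Q) (R? : Decidable R)
         (P∧Q⇒R : ∀ {x} → P x → Q x → R x) where

  -- Inclusion-exclusion: the left side counts the union plus the intersection, and the intersection
  -- lies in `R`.
  length-filter-∧ : ∀ xs → length (filter P? xs) ℕ.+ length (filter Q? xs)
                           ℕ.≤ length xs ℕ.+ length (filter R? xs)
  length-filter-∧ []       = ℕ.z≤n
  length-filter-∧ (x ∷ xs) with ih ← length-filter-∧ xs | P? x | Q? x | R? x
  ... | no _   | no _   | no _   = ℕ.m≤n⇒m≤1+n ih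
  ... | no _   | no _   | yes _  = ℕ.m≤n⇒m≤1+n (ℕ.≤-trans ih (ℕ.+-monoʳ-≤ _ (ℕ.n≤1+n _)))
  ... | no _   | yes _  | no _   = ℕ.≤-trans (ℕ.≤-reflexive (ℕ.+-suc _ _)) (ℕ.s≤s ih)
  ... | no _   | yes _  | yes _  = ℕ.≤-trans (ℕ.≤-reflexive (ℕ.+-suc _ _))
                                     (ℕ.s≤s (ℕ.≤-trans ih (ℕ.+-monoʳ-≤ _ (ℕ.n≤1+n _))))
  ... | yes _  | no _   | no _   = ℕ.s≤s ih
  ... | yes _  | no _   | yes _  = ℕ.s≤s (ℕ.≤-trans ih (ℕ.+-monoʳ-≤ _ (ℕ.n≤1+n _)))
  ... | yes _  | yes _  | yes _  = ℕ.s≤s (subst₂ ℕ._≤_ (sym (ℕ.+-suc _ _)) (sym (ℕ.+-suc _ _))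
                                     (ℕ.s≤s ih))
  ... | yes px | yes qx | no ¬rx = contradiction (P∧Q⇒R px qx) ¬rx

-- Substitution and satisfaction.

module _ {L : Language ℓ} (M : Structure L c e) where
  open Structure M

  mutual
    eval-subst : ∀ {ρ : Fin n → Carrier} {ρ′ : Fin m → Carrier} {σ : Fin m → Term L n} →
                 (∀ x → eval M ρ (σ x) ≡ ρ′ x) →
                 ∀ t → eval M ρ (substᵗ σ t) ≡ eval M ρ′ t
    eval-subst σ≗ (var x)    = σ≗ x
    eval-subst σ≗ (app f ts) = cong (interp f) (evals-subst σ≗ ts)

    evals-subst : ∀ {ρ : Fin n → Carrier} {ρ′ : Fin m → Carrier} {σ : Fin m → Term L n} →
                  (∀ x → eval M ρ (σ x) ≡ ρ′ x) →
                  ∀ (ts : Vec (Term L m) k) → evals M ρ (substᵗˢ σ ts) ≡ evals M ρ′ ts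
    evals-subst σ≗ []       = refl
    evals-subst σ≗ (t ∷ ts) = cong₂ _∷_ (eval-subst σ≗ t) (evals-subst σ≗ ts)

  eval-lift : ∀ {ρ : Fin n → Carrier} {ρ′ : Fin m → Carrier} {σ : Fin m → Term L n} →
              (∀ x → eval M ρ (σ x) ≡ ρ′ x) →
              ∀ b x → eval M (extend M b ρ) (lift σ x) ≡ extend M b ρ′ x
  eval-lift         σ≗ b Fin.zero    = refl
  eval-lift {σ = σ} σ≗ b (Fin.suc x) = trans (eval-subst (λ _ → refl) (σ x)) (σ≗ x)

  -- The assignment `ρ′` need only agree pointwise with the values of `σ`, which is all that
  -- survives extension under a quantifier. Both directions go together because negation and
  -- implication exchange them.
  Sat-subst : ∀ {ρ : Fin n → Carrier} {ρ′ : Fin m → Carrier} {σ : Fin m → Term L n} →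
              (∀ x → eval M ρ (σ x) ≡ ρ′ x) →
              ∀ φ → Sat M ρ (substᶠ σ φ) ⇔ Sat M ρ′ φ
  Sat-subst σ≗ (t ≈̇ u) = mk⇔
    (λ (lift↑ h) → lift↑ (subst₂ _≈_ (eval-subst σ≗ t) (eval-subst σ≗ u) h))
    (λ (lift↑ h) → lift↑ (subst₂ _≈_ (sym (eval-subst σ≗ t)) (sym (eval-subst σ≗ u)) h))
  Sat-subst σ≗ (¬̇ φ)   = let φ⇔ = Sat-subst σ≗ φ in mk⇔ (_∘ from φ⇔) (_∘ to φ⇔)
  Sat-subst σ≗ (φ ∧̇ ψ) = let φ⇔ = Sat-subst σ≗ φ ; ψ⇔ = Sat-subst σ≗ ψ in mk⇔
    (λ (x , y) → to φ⇔ x , to ψ⇔ y)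
    (λ (x , y) → from φ⇔ x , from ψ⇔ y)
  Sat-subst σ≗ (φ ∨̇ ψ) = let φ⇔ = Sat-subst σ≗ φ ; ψ⇔ = Sat-subst σ≗ ψ in mk⇔
    (Sum.map (to φ⇔) (to ψ⇔))
    (Sum.map (from φ⇔) (from ψ⇔))
  Sat-subst σ≗ (φ ⇒̇ ψ) = let φ⇔ = Sat-subst σ≗ φ ; ψ⇔ = Sat-subst σ≗ ψ in mk⇔
    (λ h → to ψ⇔ ∘ h ∘ from φ⇔)
    (λ h → from ψ⇔ ∘ h ∘ to φ⇔)
  Sat-subst σ≗ (∀̇ φ)   = mk⇔
    (λ h b → to (Sat-subst (eval-lift σ≗ b) φ) (h b))
    (λ h b → from (Sat-subst (eval-lift σ≗ b) φ) (h b))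
  Sat-subst σ≗ (∃̇ φ)   = mk⇔
    (map₂ λ {b} → to (Sat-subst (eval-lift σ≗ b) φ))
    (map₂ λ {b} → from (Sat-subst (eval-lift σ≗ b) φ))

  -- Both sides are equivalent to satisfaction of `substᶠ var φ` under `ρ`, so no new induction is
  -- required.
  Sat-cong : ∀ {ρ ρ′ : Fin n → Carrier} → ρ ≗ ρ′ → ∀ φ → Sat M ρ φ ⇔ Sat M ρ′ φ
  Sat-cong {ρ = ρ} {ρ′} ρ≗ρ′ φ = mk⇔
    (to (Sat-subst ρ≗ρ′ φ) ∘ from (Sat-subst {σ = var} (λ _ → refl) φ))
    (to (Sat-subst {σ = var} (λ _ → refl) φ) ∘ from (Sat-subst ρ≗ρ′ φ))

-- Satisfaction in presented structures.

module _ {L : Language ℓ} (V : Variety L) {m : ℕ} (R : List (Identity L m)) where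

  -- A closed term evaluates to itself in `⟨ V ⟩ R`, so assigning closed terms to variables and
  -- substituting them amount to the same.
  Sat-⟨⟩-substᶠ : (σ : Fin n → ClosedTerm (L ⊕ m)) (φ : Formula (L ⊕ m) n) →
                  ⟨ V ⟩ R ⊨ substᶠ σ φ ⇔ Sat (⟨ V ⟩ R) σ φ
  Sat-⟨⟩-substᶠ σ = Sat-subst (⟨ V ⟩ R) (λ x → eval-⟨⟩ V R (σ x))

  Sat-⟨⟩-extend : ∀ R′ t (σ : Fin n → ClosedTerm (L ⊕ m)) φ →
                  Sat (⟨ V ⟩ R) (extend (⟨ V ⟩ R′) t σ) φ ⇔ Sat (⟨ V ⟩ R) (extend (⟨ V ⟩ R) t σ) φ
  Sat-⟨⟩-extend R′ t σ = Sat-cong (⟨ V ⟩ R) λ where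
    Fin.zero    → refl
    (Fin.suc _) → refl

  Sat-⟨⟩-[] : (t : ClosedTerm (L ⊕ m)) (φ : Formula (L ⊕ m) 1) →
              ⟨ V ⟩ R ⊨ φ [ t ] ⇔ Sat (⟨ V ⟩ R) (extend (⟨ V ⟩ R) t noVars) φ
  Sat-⟨⟩-[] t = Sat-subst (⟨ V ⟩ R) (λ { Fin.zero → eval-⟨⟩ V R t })

-- Properties of presentations with density 1.

module _ (em : ExcludedMiddle (suc ℓ)) {L : Language ℓ} (V : Variety L)
         {m k : ℕ} (𝒫 : Presentations L m k) where
  open Presentations 𝒫
  open Density em V 𝒫

  private
    ⟪_⟫ : List (Identity L m) → Structure (L ⊕ m) ℓ (suc ℓ)
    ⟪_⟫ = ⟨ V ⟩

  -- `S φ` unfolds to the case where `Q R` is truth of `φ` in the structure presented by `R`.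
  -- General properties are allowed so that formulas under assignments are covered too.
  AlmostAll : Pred (List (Identity L m)) (suc ℓ) → Set
  AlmostAll Q =
    Limit (λ s → ratio (length (filter (λ R → em {Q R}) (presentations≤ s))) (P s)) 1ℚ

  module _ {Q₁ Q₂ Q₃ : Pred (List (Identity L m)) (suc ℓ)} where

    -- Taking any consequence `Q₃` in place of the conjunction makes monotonicity and the
    -- impossibility of contradictory properties instances of this lemma.
    AlmostAll-∧ : (∀ {R} → Q₁ R → Q₂ R → Q₃ R) → AlmostAll Q₁ → AlmostAll Q₂ → AlmostAll Q₃
    AlmostAll-∧ Q₁∧Q₂⇒Q₃ = Limit-1-∧ (proportion≤1 Q₁) (proportion≤1 Q₂) (proportion≤1 Q₃)
      (λ s → ratio-+-≤ (P s) (length-filter-∧ (λ R → em) (λ R → em) (λ R → em) Q₁∧Q₂⇒Q₃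
                                              (presentations≤ s)))
      where
      proportion≤1 : ∀ (Q : Pred (List (Identity L m)) (suc ℓ)) s →
        ratio (length (filter (λ R → em {Q R}) (presentations≤ s))) (P s) ℚ.≤ 1ℚ
      proportion≤1 Q s = ratio-≤1 (P s) (length-filter (λ R → em {Q R}) (presentations≤ s))

  module _ {Q₁ Q₂ : Pred (List (Identity L m)) (suc ℓ)} where

    AlmostAll-map : (∀ {R} → Q₁ R → Q₂ R) → AlmostAll Q₁ → AlmostAll Q₂
    AlmostAll-map Q₁⇒Q₂ h = AlmostAll-∧ {Q₁} {Q₁} {Q₂} (λ x _ → Q₁⇒Q₂ x) h h

  -- Otherwise the empty property would have density 1, but its proportion is always 0, which is not
  -- within distance 1 of 1.
  AlmostAll-consistent : ∀ {Q : Pred (List (Identity L m)) (suc ℓ)} →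
                         AlmostAll Q → ¬ AlmostAll (λ R → ¬ Q R)
  AlmostAll-consistent {Q} h h′ =
    ℚ.<-irrefl {1ℚ} refl (subst (λ x → ℚ.∣ x ℚ.- 1ℚ ∣ ℚ.< 1ℚ) (none N) (close N ℕ.≤-refl))
    where
    False : Pred (List (Identity L m)) (suc ℓ)
    False _ = Lift (suc ℓ) ⊥
    false→1 : AlmostAll False
    false→1 = AlmostAll-∧ {Q} {λ R → ¬ Q R} {False} (λ x ¬x → contradiction x ¬x) h h′
    N     = proj₁ (false→1 1ℚ (ℚ.positive⁻¹ 1ℚ))
    close = proj₂ (false→1 1ℚ (ℚ.positive⁻¹ 1ℚ))
    none : ∀ s → ratio (length (filter (λ R → em {False R}) (presentations≤ s))) (P s) ≡ 0ℚ
    none s = trans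
      (cong (λ xs → ratio (length xs) (P s))
            (filter-none (λ R → em {False R}) (universal (λ _ ()) (presentations≤ s))))
      (ratio-0 (P s))

  -- The proportion is exactly 1 as soon as some presentation exists; this is where `inhabited`
  -- enters, since over an empty list the ratio would be 0.
  AlmostAll-universal : ∀ {Q : Pred (List (Identity L m)) (suc ℓ)} → (∀ R → Q R) → AlmostAll Q
  AlmostAll-universal {Q} h ε 0<ε = proj₁ inhabited , λ s s₀≤s →
    subst (λ x → ℚ.∣ x ℚ.- 1ℚ ∣ ℚ.< ε) (sym (all s (proj₂ (proj₂ inhabited s s₀≤s)))) 0<ε
    where
    ratio-self : ∀ {R} {xs : List (List (Identity L m))} → R ∈ xs →
                 ratio (length xs) (length xs) ≡ 1ℚ
    ratio-self {xs = _ ∷ xs} _ = n/n≡1 (length xs)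
    all : ∀ s {R} → R ∈ presentations≤ s →
          ratio (length (filter (λ R → em {Q R}) (presentations≤ s))) (P s) ≡ 1ℚ
    all s R∈ = trans
      (cong (λ xs → ratio (length xs) (P s))
            (filter-all (λ R → em {Q R}) (universal h (presentations≤ s))))
      (ratio-self R∈)

  -- From inclusion to equality, and from equality to (b).

  T-F⊆S⇒S⊆T-F : T-F ⊆ S → S ⊆ T-F
  T-F⊆S⇒S⊆T-F T-F⊆S {φ} φ∈S = decidable-stable em λ φ∉T-F →
    AlmostAll-consistent {λ R → ⟪ R ⟫ ⊨ φ} φ∈S (T-F⊆S {¬̇ φ} φ∉T-F)

  T-F≐S⇒closedUnderGeneralization : T-F ≐ S → ClosedUnderGeneralization
  T-F≐S⇒closedUnderGeneralization (T-F⊆S , S⊆T-F) φ φ[t]∈S = T-F⊆S {∀̇ φ} λ t →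
    to (Sat-⟨⟩-[] V [] t φ) (S⊆T-F {φ [ t ]} (φ[t]∈S t))

  -- Transfer between the free structure and presented structures.

  -- The right side does not mention `R`: all presented structures share their carrier and term
  -- values, and differ only in their equality.
  eval-⟨⟩-substᵗ : ∀ R (σ : Fin n → ClosedTerm (L ⊕ m)) t → eval ⟪ R ⟫ σ t ≡ substᵗ σ t
  eval-⟨⟩-substᵗ R σ t =
    trans (sym (eval-subst ⟪ R ⟫ (λ x → eval-⟨⟩ V R (σ x)) t)) (eval-⟨⟩ V R (substᵗ σ t))

  Sat-Free-≈̇ : ∀ {σ : Fin n → ClosedTerm (L ⊕ m)} {t u} →
               Sat (Free V) σ (t ≈̇ u) → ∀ R → Sat ⟪ R ⟫ σ (t ≈̇ u)
  Sat-Free-≈̇ {σ = σ} {t} {u} (lift↑ h) R =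
    lift↑ (subst₂ (λ t u → Follows V R (t , u)) (evals-agree t) (evals-agree u)
                  -- A model of the axioms and `R` is a model of the axioms alone, and the condition
                  -- over the empty list is vacuous.
                  (λ M M∈V _ → h M M∈V λ _ ()))
    where
    evals-agree : ∀ t → eval (Free V) σ t ≡ eval ⟪ R ⟫ σ t
    evals-agree t = trans (eval-⟨⟩-substᵗ [] σ t) (sym (eval-⟨⟩-substᵗ R σ t))

  -- extend takes the structure as an argument, so the two assignments agree only pointwise.
  AlmostAll-extend : ∀ t (σ : Fin n → ClosedTerm (L ⊕ m)) φ →
                     AlmostAll (λ R → Sat ⟪ R ⟫ (extend (Free V) t σ) φ) →
                     AlmostAll (λ R → Sat ⟪ R ⟫ (extend ⟪ R ⟫ t σ) φ)
  AlmostAll-extend t σ φ = AlmostAll-map {λ R → Sat ⟪ R ⟫ (extend (Free V) t σ) φ}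
    (λ {R} → to (Sat-⟨⟩-extend V R [] t σ φ))

  -- From (a) and (b) to the inclusion of the theory of the free structure.

  module _ (inequations : ContainsFreeInequations)
           (generalization : ClosedUnderGeneralization) where

    -- Property (b) speaks of formulas with one free variable, so the other variables are first
    -- replaced by the closed terms that `σ` assigns to them.
    AlmostAll-∀ : ∀ (σ : Fin n → ClosedTerm (L ⊕ m)) φ →
                  (∀ t → AlmostAll (λ R → Sat ⟪ R ⟫ (extend ⟪ R ⟫ t σ) φ)) →
                  AlmostAll (λ R → ∀ t → Sat ⟪ R ⟫ (extend ⟪ R ⟫ t σ) φ)
    AlmostAll-∀ σ φ h =
      AlmostAll-map {λ R → ⟪ R ⟫ ⊨ ∀̇ φ′} (λ {R} → to (Sat-⟨⟩-substᶠ V R σ (∀̇ φ)))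
        (generalization φ′ λ t →
          AlmostAll-map {λ R → Sat ⟪ R ⟫ (extend ⟪ R ⟫ t σ) φ}
            (λ {R} → from (φ′-[] R t)) (h t))
      where
      φ′ = substᶠ (lift σ) φ
      φ′-[] : ∀ R t → ⟪ R ⟫ ⊨ φ′ [ t ] ⇔ Sat ⟪ R ⟫ (extend ⟪ R ⟫ t σ) φ
      φ′-[] R t = mk⇔
        (to lifted ∘ to (Sat-⟨⟩-[] V R t φ′))
        (from (Sat-⟨⟩-[] V R t φ′) ∘ from lifted)
        where lifted = Sat-subst ⟪ R ⟫ (eval-lift ⟪ R ⟫ (λ x → eval-⟨⟩ V R (σ x)) t) φ

    mutual
      -- Truth and falsity are treated simultaneously because negation and implication exchange
      -- them, and open formulas are needed to pass under quantifiers.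
      Free⇒AlmostAll : ∀ (σ : Fin n → ClosedTerm (L ⊕ m)) φ →
                       Sat (Free V) σ φ → AlmostAll (λ R → Sat ⟪ R ⟫ σ φ)
      Free⇒AlmostAll σ (t ≈̇ u) h = AlmostAll-universal (Sat-Free-≈̇ {t = t} {u} h)
      Free⇒AlmostAll σ (¬̇ φ) h = ¬Free⇒AlmostAll¬ σ φ h
      Free⇒AlmostAll σ (φ ∧̇ ψ) (x , y) =
        AlmostAll-∧ {λ R → Sat ⟪ R ⟫ σ φ} {λ R → Sat ⟪ R ⟫ σ ψ} _,_
          (Free⇒AlmostAll σ φ x) (Free⇒AlmostAll σ ψ y)
      Free⇒AlmostAll σ (φ ∨̇ ψ) (inj₁ x) =
        AlmostAll-map {λ R → Sat ⟪ R ⟫ σ φ} inj₁ (Free⇒AlmostAll σ φ x)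
      Free⇒AlmostAll σ (φ ∨̇ ψ) (inj₂ y) =
        AlmostAll-map {λ R → Sat ⟪ R ⟫ σ ψ} inj₂ (Free⇒AlmostAll σ ψ y)
      Free⇒AlmostAll σ (φ ⇒̇ ψ) h with em {Sat (Free V) σ φ}
      ... | yes x = AlmostAll-map {λ R → Sat ⟪ R ⟫ σ ψ} const (Free⇒AlmostAll σ ψ (h x))
      ... | no ¬x = AlmostAll-map {λ R → ¬ Sat ⟪ R ⟫ σ φ} (λ ¬x x → contradiction x ¬x)
                      (¬Free⇒AlmostAll¬ σ φ ¬x)
      Free⇒AlmostAll σ (∀̇ φ) h = AlmostAll-∀ σ φ λ t →
        AlmostAll-extend t σ φ (Free⇒AlmostAll (extend (Free V) t σ) φ (h t))
      Free⇒AlmostAll σ (∃̇ φ) (t , h) =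
        AlmostAll-map {λ R → Sat ⟪ R ⟫ (extend ⟪ R ⟫ t σ) φ} (t ,_)
          (AlmostAll-extend t σ φ (Free⇒AlmostAll (extend (Free V) t σ) φ h))

      ¬Free⇒AlmostAll¬ : ∀ (σ : Fin n → ClosedTerm (L ⊕ m)) φ →
                         ¬ Sat (Free V) σ φ → AlmostAll (λ R → ¬ Sat ⟪ R ⟫ σ φ)
      ¬Free⇒AlmostAll¬ σ (t ≈̇ u) h =
        AlmostAll-map {λ R → ⟪ R ⟫ ⊨ ¬̇ (t′ ≈̇ u′)} (λ {R} → to (Sat-⟨⟩-substᶠ V R σ (¬̇ (t ≈̇ u))))
          (inequations t′ u′ (from (Sat-⟨⟩-substᶠ V [] σ (¬̇ (t ≈̇ u))) h))
        where
        t′ = substᵗ σ t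
        u′ = substᵗ σ u
      ¬Free⇒AlmostAll¬ σ (¬̇ φ) h =
        AlmostAll-map {λ R → Sat ⟪ R ⟫ σ φ} (λ x ¬x → ¬x x)
          (Free⇒AlmostAll σ φ (decidable-stable em h))
      ¬Free⇒AlmostAll¬ σ (φ ∧̇ ψ) h with em {Sat (Free V) σ φ}
      ... | yes x = AlmostAll-map {λ R → ¬ Sat ⟪ R ⟫ σ ψ} (_∘ proj₂)
                      (¬Free⇒AlmostAll¬ σ ψ λ y → h (x , y))
      ... | no ¬x = AlmostAll-map {λ R → ¬ Sat ⟪ R ⟫ σ φ} (_∘ proj₁)
                      (¬Free⇒AlmostAll¬ σ φ ¬x)
      ¬Free⇒AlmostAll¬ σ (φ ∨̇ ψ) h =
        AlmostAll-∧ {λ R → ¬ Sat ⟪ R ⟫ σ φ} {λ R → ¬ Sat ⟪ R ⟫ σ ψ} (λ ¬x ¬y → Sum.[ ¬x , ¬y ])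
          (¬Free⇒AlmostAll¬ σ φ (h ∘ inj₁)) (¬Free⇒AlmostAll¬ σ ψ (h ∘ inj₂))
      ¬Free⇒AlmostAll¬ σ (φ ⇒̇ ψ) h =
        AlmostAll-∧ {λ R → Sat ⟪ R ⟫ σ φ} {λ R → ¬ Sat ⟪ R ⟫ σ ψ} (λ x ¬y x⇒y → ¬y (x⇒y x))
          (Free⇒AlmostAll σ φ (decidable-stable em λ ¬x → h λ x → contradiction x ¬x))
          (¬Free⇒AlmostAll¬ σ ψ λ y → h (const y))
      ¬Free⇒AlmostAll¬ σ (∀̇ φ) h
        with em {∃[ t ] ¬ Sat (Free V) (extend (Free V) t σ) φ}
      -- The carriers coincide, so the one counterexample `t` from the free structure serves for
      -- almost all `R`.
      ... | yes (t , ¬x) =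
              AlmostAll-map {λ R → ¬ Sat ⟪ R ⟫ (extend ⟪ R ⟫ t σ) φ} (λ ¬x x → ¬x (x t))
                (AlmostAll-extend t σ (¬̇ φ) (¬Free⇒AlmostAll¬ (extend (Free V) t σ) φ ¬x))
      ... | no ∄ = contradiction (λ t → decidable-stable em λ ¬x → ∄ (t , ¬x)) h
      ¬Free⇒AlmostAll¬ σ (∃̇ φ) h =
        AlmostAll-map {λ R → ∀ t → ¬ Sat ⟪ R ⟫ (extend ⟪ R ⟫ t σ) φ} (λ ¬x (t , x) → ¬x t x)
          -- A failing existential is a universal statement about the negation, so (b) applies
          -- again.
          (AlmostAll-∀ σ (¬̇ φ) λ t →
            AlmostAll-extend t σ (¬̇ φ) (¬Free⇒AlmostAll¬ (extend (Free V) t σ) φ λ x → h (t , x)))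

proposition5p1 : ∀ {ℓ : Level} (em : ExcludedMiddle (suc ℓ))
    (L : Language ℓ) (V : Variety L) (m k : ℕ) (𝒫 : Presentations L m k) →
    let open Density em V 𝒫 in
    ((T-F ⊆ S) ⇔ (T-F ≐ S)) ×
    ((T-F ≐ S) ⇔ (ContainsFreeInequations × ClosedUnderGeneralization))
proposition5p1 em L V m k 𝒫 =
  mk⇔ (λ T-F⊆S → equality λ {φ} → T-F⊆S {φ}) (λ (T-F⊆S , _) {φ} → T-F⊆S {φ}) ,
  mk⇔ (λ T-F≐S → (λ t t′ → proj₁ T-F≐S {¬̇ (t ≈̇ t′)}) ,
                 T-F≐S⇒closedUnderGeneralization em V 𝒫 T-F≐S)
      -- The induction at the empty assignment yields the inclusion, which `equality` then
      -- strengthens.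
      (λ (inequations , generalization) → equality λ {φ} →
        Free⇒AlmostAll em V 𝒫 inequations generalization noVars φ)
  where
  open Density em V 𝒫
  equality : T-F ⊆ S → T-F ≐ S
  equality T-F⊆S = (λ {φ} → T-F⊆S {φ}) , λ {φ} → T-F⊆S⇒S⊆T-F em V 𝒫 (λ {φ} → T-F⊆S {φ}) {φ}
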